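{- As sequences indexed by $n\geq1$, $\mathrm{orb}^\sigma=\mathrm{orb}^\sigma_1\ast\mathbf{1}$ and $\mathrm{orb}^\sigma_1=\mathrm{A113788}$; that is, for every $n\geq1$, $\mathrm{orb}^\sigma(n)=\sum_{d\mid n}\mathrm{orb}^\sigma_1(d)$ and $\mathrm{orb}^\sigma_1(n)=\frac1n\sum_{d\mid n}p(d)\,\mu(n/d)$.
   Context: For $n\geq1$ let $V_n=\{v_0,\dots,v_{n-1}\}$, indices modulo $n$, and let the cyclic group $\langle\sigma\rangle=\{1,\sigma,\dots,\sigma^{n-1}\}$ act on subsets of $V_n$ via $\sigma(v_i)=v_{i+1}$. Let $\mathbf{X}_n$ be the family of subsets $X\subseteq V_n$ such that (a) there is no $i\in\mathbb{Z}_n$ with $v_i,v_{i+1}\in X$, and (b) for every $i\in\mathbb{Z}_n$ at least one of $v_i,v_{i+1},v_{i+2}$ lies in $X$ (for $n\geq 3$: the maximal independent sets of the cycle graph $C_n$). $\mathrm{orb}^\sigma(n)$ is the number of $\langle\sigma\rangle$-orbits of $\mathbf{X}_n$ (unlabeled MISs), and for $d\mid n$, $\mathrm{orb}^\sigma_d(n)$ is the number of these orbits of cardinality $n/d$. Perrin: $p(1)=0,p(2)=2,p(3)=3$, $p(n)=p(n-2)+p(n-3)$ ($n\geq4$). Dirichlet convolution $(f\ast g)(n)=\sum_{d\mid n}f(d)g(n/d)$; $\mu$ Möbius function; $\mathbf{1}(n)=1$; $\mathrm{A113788}(n)=\frac1n(p\ast\mu)(n)$. -}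

module Defs where

open import Data.Bool.Base using (if_then_else_)
open import Data.Bool.Properties using () renaming (_≟_ to _≟ᵇ_)
open import Data.Fin.Base using (Fin; toℕ)
open import Data.Fin.Properties using (any?; all?) renaming (_≟_ to _≟ᶠ_)
open import Data.Fin.Subset using (Subset; inside; outside; _∈_)
open import Data.Fin.Subset.Properties using (_∈?_)
open import Data.Integer.Base as ℤ using (ℤ; 0ℤ; 1ℤ; -1ℤ)
open import Data.List.Base
  using (List; []; _∷_; [_]; length; map; foldr; filter; upTo; deduplicate; cartesianProductWith)
import Data.List.Properties as List
open import Data.List.Relation.Unary.Unique.DecPropositional using (unique?)
open import Data.Nat.Base using (ℕ; zero; suc; _+_; _/_; NonZero)
open import Data.Nat.DivMod using (_mod_)
open import Data.Nat.Divisibility using (_∣?_)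
open import Data.Nat.GeneralisedArithmetic using (iterate)
open import Data.Nat.Primality.Factorisation using (factorise; factors)
open import Data.Nat.Properties using (_≟_)
open import Data.Product.Base using (_×_; ∃)
open import Data.Rational.Base as ℚ using (ℚ)
open import Data.Sum.Base using (_⊎_)
import Data.Vec.Base as Vec
import Data.Vec.Properties as Vec
open import Relation.Binary.Definitions using (DecidableEquality)
open import Relation.Binary.PropositionalEquality.Core using (_≡_)
open import Relation.Nullary.Decidable
  using (Dec; does; ¬?; _×-dec_; _⊎-dec_)
open import Relation.Nullary.Negation using (¬_)

private
  variable
    n : ℕ

-- v_i ↦ v_{i+1}, indices modulo n.
next : Fin n → Fin n
next {n@(suc _)} i = suc (toℕ i) mod n

_≟ˢ_ : DecidableEquality (Subset n)
_≟ˢ_ = Vec.≡-dec _≟ᵇ_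

-- The image { next i | i ∈ X }.
σ : Subset n → Subset n
σ X = Vec.tabulate λ j → does (any? λ i → (i ∈? X) ×-dec (next i ≟ᶠ j))

Independent : Subset n → Set
Independent X = ¬ (∃ λ i → i ∈ X × next i ∈ X)

Dominating : Subset n → Set
Dominating X = ∀ i → i ∈ X ⊎ next i ∈ X ⊎ next (next i) ∈ X

-- For n ≥ 3 these are the maximal independent sets of the cycle graph Cₙ; for
-- n ≤ 2 the conditions are taken as they stand, so no set qualifies when n = 1.
IsMIS : Subset n → Set
IsMIS X = Independent X × Dominating X

isMIS? : (X : Subset n) → Dec (IsMIS X)
isMIS? X =
  ¬? (any? λ i → (i ∈? X) ×-dec (next i ∈? X))
  ×-dec
  all? λ i → (i ∈? X) ⊎-dec (next i ∈? X) ⊎-dec (next (next i) ∈? X)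

-- Every subset occurs exactly once.
subsets : ∀ n → List (Subset n)
subsets zero    = [ Vec.[] ]
subsets (suc n) = cartesianProductWith Vec._∷_ (inside ∷ outside ∷ []) (subsets n)

𝐗 : ∀ n → List (Subset n)
𝐗 n = filter isMIS? (subsets n)

-- Y = σᵏ X for some σᵏ in ⟨σ⟩ = {1, σ, …, σⁿ⁻¹}.
_∈Orbit_ : Subset n → Subset n → Set
_∈Orbit_ {n} Y X = ∃ λ (k : Fin n) → iterate σ X (toℕ k) ≡ Y

_∈Orbit?_ : (Y X : Subset n) → Dec (Y ∈Orbit X)
Y ∈Orbit? X = any? λ k → iterate σ X (toℕ k) ≟ˢ Y

-- The members of an orbit are listed without repetition and in the order of
-- `subsets n`.  Hence two orbits are equal as sets iff they are equal as lists,
-- and the length of the list is the cardinality of the orbit.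
orbit : Subset n → List (Subset n)
orbit {n} X = filter (_∈Orbit? X) (subsets n)

orbits : ∀ n → List (List (Subset n))
orbits n = deduplicate (List.≡-dec _≟ˢ_) (map orbit (𝐗 n))

orbσ : ℕ → ℕ
orbσ n = length (orbits n)

-- Meaningful when d divides n, so that n / d is the exact quotient.
orbσ[_] : (d : ℕ) .{{_ : NonZero d}} → ℕ → ℕ
orbσ[ d ] n = length (filter (λ O → length O ≟ n / d) (orbits n))

-- Sequences indexed by n ≥ 1 are represented by functions on ℕ; their values
-- at 0 are irrelevant, and the convolution below never uses them when n ≥ 1.

p : ℕ → ℕ
p 0 = 3
p 1 = 0
p 2 = 2
p 3 = 3
p (suc (suc (suc (suc n)))) = p (suc (suc n)) + p (suc n)

𝟏 : ℕ → ℤ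
𝟏 _ = 1ℤ

-- μ(n) = (-1)ʳ if n is a product of r distinct primes, and 0 otherwise.
μ : ℕ → ℤ
μ zero      = 0ℤ
μ n@(suc _) = if does (unique? _≟_ ps) then -1ℤ ℤ.^ length ps else 0ℤ
  where ps = factors (factorise n)

-- The divisor d ranges over suc k for k < n.
infixl 7 _∗_
_∗_ : (ℕ → ℤ) → (ℕ → ℤ) → ℕ → ℤ
(f ∗ g) n =
  foldr ℤ._+_ 0ℤ
    (map (λ k → f (suc k) ℤ.* g (n / suc k))
         (filter (λ k → suc k ∣? n) (upTo n)))

A113788 : (n : ℕ) .{{_ : NonZero n}} → ℚ
A113788 n = (((λ m → ℤ.+ p m) ∗ μ) n) ℚ./ n

{-# OPTIONS --safe #-}
module Submission where

-- Read X ⊆ ℤₙ as a periodic 0/1 sequence and let d be its minimal period. Then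
-- d divides n, the orbit of X has d elements, and X is determined by its
-- restriction to ℤ_d, a member of 𝐗 d whose orbit has d elements too. So the
-- orbits of cardinality d in 𝐗 n correspond to those in 𝐗 d, and summing over d
-- gives the first equation. Summing cardinalities instead gives
-- |𝐗 n| = Σ_{d ∣ n} d · orbσ[ 1 ] d, and Möbius inversion gives the second
-- equation, because |𝐗 n| = p n: members of 𝐗 n are the closed walks of length
-- n through the admissible pairs 00, 01, 10 of consecutive values, and these
-- numbers of walks satisfy Perrin's recurrence.

open import Defs
open import Data.Bool.Base using (Bool; true; false; if_then_else_)
open import Data.Bool.Properties using () renaming (_≟_ to _≟ᵇ_)
open import Data.Fin.Base as Fin using (Fin; toℕ)
open import Data.Fin.Properties
  using (any?; toℕ-fromℕ<; toℕ-injective; toℕ<n) renaming (_≟_ to _≟ᶠ_)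
open import Data.Fin.Subset using (Subset; inside; outside) renaming (_∈_ to _∈ˢ_)
open import Data.Fin.Subset.Properties using (_∈?_)
open import Data.Integer.Base as ℤ using (ℤ; 0ℤ; 1ℤ; -1ℤ; +_)
import Data.Integer.Properties as ℤ
open import Data.List.Base using (List; []; _∷_; [_]; length; map; foldr; filter; upTo; _++_)
import Data.List.Properties as List
open import Data.List.Membership.Propositional using (_∈_)
open import Data.List.Membership.Propositional.Properties
  using ( ∈-map⁺; ∈-map⁻; ∈-cartesianProductWith⁺; ∈-upTo⁺; ∈-upTo⁻; ∈-filter⁺; ∈-filter⁻
        ; ∈-deduplicate⁺; ∈-deduplicate⁻)
open import Data.List.Relation.Binary.Permutation.Propositional using (_↭_; ↭-sym; ↭⇒↭ₛ)
open import Data.List.Relation.Binary.Permutation.Propositional.Properties using (↭-length)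
open import Data.List.Relation.Binary.Permutation.Setoid.Properties using (Unique-resp-↭)
open import Data.List.Relation.Unary.All as All using ([]; _∷_)
open import Data.List.Relation.Unary.AllPairs using ([]; _∷_)
open import Data.List.Relation.Unary.Any using (here; there)
open import Data.List.Relation.Unary.Unique.DecPropositional using (unique?)
open import Data.List.Relation.Unary.Unique.DecPropositional.Properties using (deduplicate-!)
open import Data.List.Relation.Unary.Unique.Propositional using (Unique)
open import Data.List.Relation.Unary.Unique.Propositional.Properties
  using (filter⁺; upTo⁺; cartesianProductWith⁺)
open import Data.Nat.Base as ℕ hiding (_/_)
open import Data.Nat.Coprimality using (Coprime; coprime-divisor)
open import Data.Nat.DivMod hiding (_/_)
open import Data.Nat.Divisibility
open import Data.Nat.GeneralisedArithmetic using (iterate)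
open import Data.Nat.Induction using (<-rec)
open import Data.Nat.ListAction using (product)
open import Data.Nat.ListAction.Properties using (∈⇒∣product)
open import Data.Nat.Primality using (Prime; prime⇒nonZero; prime⇒irreducible)
open import Data.Nat.Primality.Factorisation
open import Data.Nat.Properties
open import Data.Product.Base using (_×_; _,_; ∃; proj₁; proj₂)
open import Data.Rational.Base using (_/_)
import Data.Rational.Properties as ℚ
open import Data.Rational.Unnormalised.Base using (mkℚᵘ; *≡*)
open import Data.Sum.Base as Sum using (_⊎_; inj₁; inj₂)
open import Data.Vec.Base as Vec using (Vec; []; _∷_; lookup; tabulate)
open import Data.Vec.Properties
  using ([]=⇒lookup; lookup⇒[]=; tabulate∘lookup; tabulate-cong; lookup∘tabulate)
open import Function.Base using (_∘_; const; id)
open import Function.Bundles using (_⇔_; mk⇔; Equivalence)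
open import Relation.Binary.Definitions using (DecidableEquality)
open import Relation.Binary.PropositionalEquality hiding ([_])
open import Relation.Nullary.Decidable
  using (Dec; yes; no; does; dec-true; dec-false; does-⇔; map′; ¬?; _×-dec_; _⊎-dec_)
open import Relation.Nullary.Negation using (contradiction; ¬_)
open import Relation.Unary using (Decidable)
import Algebra.Properties.CommutativeSemigroup ℤ.+-commutativeSemigroup as ℤ+
import Algebra.Properties.CommutativeSemigroup ℤ.*-commutativeSemigroup as ℤ*
open Equivalence using (to; from)
open ≡-Reasoning

-- Sets for different `n` have different types `Subset n`, so they are compared through their
-- sequences `ext X : ℕ → Bool`: restriction to a shorter cycle and unrolling to a longer one leave
-- the sequence unchanged, and membership in `𝐗 n`, the periods and the orbit size can all be read
-- off from it. Orbits, being lists of subsets, have no such common home. Hence the passage from `n`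
-- to `d ∣ n` counts sets whose orbit has `d` elements; each orbit of that size holds `d` of them,
-- and this factor is cancelled afterwards.
--
-- The steps between the pairs 00, 01, 10 are 00 → 01, 01 → 10, 10 → 01 and 10 → 00. Their transfer
-- matrix has characteristic polynomial x³ - x - 1, which is where Perrin's recurrence comes from;
-- the proof derives it entry by entry, without matrices.

private
  variable
    m n : ℕ
    A B : Set
    P : A → Set

-- Finite sums

-- This shape makes `_∗_` unfold to a `∑` over a filtered list; integer values leave room for the
-- signs of `μ`.
∑ : List A → (A → ℤ) → ℤ
∑ xs f = foldr ℤ._+_ 0ℤ (map f xs)

𝟙 : {P : Set} → Dec P → ℤ
𝟙 P? = if does P? then 1ℤ else 0ℤ

∑-cong : (xs : List A) {f g : A → ℤ} → (∀ {x} → x ∈ xs → f x ≡ g x) → ∑ xs f ≡ ∑ xs g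
∑-cong []       f≗g = refl
∑-cong (x ∷ xs) f≗g = cong₂ ℤ._+_ (f≗g (here refl)) (∑-cong xs (f≗g ∘ there))

∑-zero : (xs : List A) → ∑ xs (const 0ℤ) ≡ 0ℤ
∑-zero []       = refl
∑-zero (_ ∷ xs) = trans (ℤ.+-identityˡ _) (∑-zero xs)

∑-+ : (xs : List A) (f g : A → ℤ) → ∑ xs (λ x → f x ℤ.+ g x) ≡ ∑ xs f ℤ.+ ∑ xs g
∑-+ []       f g = refl
∑-+ (x ∷ xs) f g = begin
  f x ℤ.+ g x ℤ.+ ∑ xs (λ x → f x ℤ.+ g x)     ≡⟨ cong (λ s → f x ℤ.+ g x ℤ.+ s) (∑-+ xs f g) ⟩
  f x ℤ.+ g x ℤ.+ (∑ xs f ℤ.+ ∑ xs g)           ≡⟨ ℤ+.interchange (f x) (g x) _ _ ⟩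
  f x ℤ.+ ∑ xs f ℤ.+ (g x ℤ.+ ∑ xs g)           ∎

∑-swap : (xs : List A) (ys : List B) (h : A → B → ℤ) →
         ∑ xs (λ x → ∑ ys (h x)) ≡ ∑ ys (λ y → ∑ xs (λ x → h x y))
∑-swap []       ys h = sym (∑-zero ys)
∑-swap (x ∷ xs) ys h = begin
  ∑ ys (h x) ℤ.+ ∑ xs (λ x → ∑ ys (h x))          ≡⟨ cong (λ s → ∑ ys (h x) ℤ.+ s) (∑-swap xs ys h) ⟩
  ∑ ys (h x) ℤ.+ ∑ ys (λ y → ∑ xs (λ x → h x y))  ≡⟨ ∑-+ ys (h x) _ ⟨
  ∑ ys (λ y → ∑ (x ∷ xs) (λ x → h x y))           ∎

∑-*ˡ : (c : ℤ) (xs : List A) (f : A → ℤ) → ∑ xs (λ x → c ℤ.* f x) ≡ c ℤ.* ∑ xs f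
∑-*ˡ c []       f = sym (ℤ.*-zeroʳ c)
∑-*ˡ c (x ∷ xs) f = trans (cong (λ s → c ℤ.* f x ℤ.+ s) (∑-*ˡ c xs f)) (sym (ℤ.*-distribˡ-+ c (f x) (∑ xs f)))

∑-*ʳ : (xs : List A) (f : A → ℤ) (c : ℤ) → ∑ xs (λ x → f x ℤ.* c) ≡ ∑ xs f ℤ.* c
∑-*ʳ []       f c = refl
∑-*ʳ (x ∷ xs) f c = trans (cong (λ s → f x ℤ.* c ℤ.+ s) (∑-*ʳ xs f c)) (sym (ℤ.*-distribʳ-+ c (f x) (∑ xs f)))

∑-++ : (xs ys : List A) (f : A → ℤ) → ∑ (xs ++ ys) f ≡ ∑ xs f ℤ.+ ∑ ys f
∑-++ []       ys f = sym (ℤ.+-identityˡ _)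
∑-++ (x ∷ xs) ys f = trans (cong (λ s → f x ℤ.+ s) (∑-++ xs ys f)) (sym (ℤ.+-assoc (f x) _ _))

∑-map : (h : A → B) (f : B → ℤ) (xs : List A) → ∑ (map h xs) f ≡ ∑ xs (f ∘ h)
∑-map h f xs = cong (foldr ℤ._+_ 0ℤ) (sym (List.map-∘ xs))

∑-1 : (xs : List A) → ∑ xs (const 1ℤ) ≡ + length xs
∑-1 []       = refl
∑-1 (_ ∷ xs) = cong ℤ.suc (∑-1 xs)

∑-filter : (P? : Decidable P) (f : A → ℤ) (xs : List A) →
           ∑ (filter P? xs) f ≡ ∑ xs (λ x → 𝟙 (P? x) ℤ.* f x)
∑-filter P? f [] = refl
∑-filter P? f (x ∷ xs) with does (P? x)
... | true  = cong₂ ℤ._+_ (sym (ℤ.*-identityˡ (f x))) (∑-filter P? f xs)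
... | false = trans (∑-filter P? f xs) (sym (ℤ.+-identityˡ _))

∑-𝟙 : (P? : Decidable P) (xs : List A) → ∑ xs (λ x → 𝟙 (P? x)) ≡ + length (filter P? xs)
∑-𝟙 P? xs = begin
  ∑ xs (λ x → 𝟙 (P? x))            ≡⟨ ∑-cong xs (λ _ → sym (ℤ.*-identityʳ _)) ⟩
  ∑ xs (λ x → 𝟙 (P? x) ℤ.* 1ℤ)     ≡⟨ ∑-filter P? (const 1ℤ) xs ⟨
  ∑ (filter P? xs) (const 1ℤ)       ≡⟨ ∑-1 (filter P? xs) ⟩
  + length (filter P? xs)           ∎

∑-split : (P? : Decidable P) (f : A → ℤ) (xs : List A) →
          ∑ xs f ≡ ∑ (filter P? xs) f ℤ.+ ∑ (filter (¬? ∘ P?) xs) f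
∑-split P? f [] = refl
∑-split P? f (x ∷ xs) with does (P? x)
... | true  = trans (cong (λ s → f x ℤ.+ s) (∑-split P? f xs)) (sym (ℤ.+-assoc (f x) _ _))
... | false = trans (cong (λ s → f x ℤ.+ s) (∑-split P? f xs))
                    (ℤ+.x∙yz≈y∙xz (f x) (∑ (filter P? xs) f) (∑ (filter (¬? ∘ P?) xs) f))

filter-! : (P? : Decidable P) {x : A} {xs : List A} → Unique xs → x ∈ xs → P x →
           (∀ {y} → y ∈ xs → P y → y ≡ x) → filter P? xs ≡ [ x ]
filter-! P? {xs = x ∷ xs} (x∉xs ∷ xs!) (here refl) Px unique =
  trans (List.filter-accept P? Px) (cong (x ∷_) (List.filter-none P? (All.tabulate λ y∈xs Py →
    contradiction (sym (unique (there y∈xs) Py)) (All.lookup x∉xs y∈xs))))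
filter-! P? {xs = x ∷ xs} (x∉xs ∷ xs!) (there y∈xs) Py unique =
  trans (List.filter-reject P? λ Px → All.lookup x∉xs y∈xs (unique (here refl) Px))
        (filter-! P? xs! y∈xs Py (unique ∘ there))

module _ (_≟_ : DecidableEquality B) where

  ∑-pick : {z : B} {ys : List B} (g : B → ℤ) → Unique ys → z ∈ ys → ∑ ys (λ y → 𝟙 (z ≟ y) ℤ.* g y) ≡ g z
  ∑-pick {z} {ys} g ys! z∈ys = begin
    ∑ ys (λ y → 𝟙 (z ≟ y) ℤ.* g y)  ≡⟨ ∑-filter (z ≟_) g ys ⟨
    ∑ (filter (z ≟_) ys) g
      ≡⟨ cong (λ zs → ∑ zs g) (filter-! (z ≟_) ys! z∈ys refl (λ _ → sym)) ⟩
    g z ℤ.+ 0ℤ                       ≡⟨ ℤ.+-identityʳ (g z) ⟩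
    g z                              ∎

  -- Double counting: `g (φ x)` is spread over all `y` by the indicator of `φ x ≡ y`, and the two
  -- sums are interchanged.
  ∑-fibre : (φ : A → B) (g : B → ℤ) {xs : List A} {ys : List B} → Unique ys →
            (∀ {x} → x ∈ xs → φ x ∈ ys) →
            ∑ xs (g ∘ φ) ≡ ∑ ys (λ y → + length (filter (λ x → φ x ≟ y) xs) ℤ.* g y)
  ∑-fibre φ g {xs} {ys} ys! φ∈ = begin
    ∑ xs (g ∘ φ)
      ≡⟨ ∑-cong xs (λ x∈xs → sym (∑-pick g ys! (φ∈ x∈xs))) ⟩
    ∑ xs (λ x → ∑ ys (λ y → 𝟙 (φ x ≟ y) ℤ.* g y))
      ≡⟨ ∑-swap xs ys _ ⟩
    ∑ ys (λ y → ∑ xs (λ x → 𝟙 (φ x ≟ y) ℤ.* g y))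
      ≡⟨ ∑-cong ys (λ {y} _ → trans (∑-*ʳ xs _ (g y)) (cong (ℤ._* g y) (∑-𝟙 (λ x → φ x ≟ y) xs))) ⟩
    ∑ ys (λ y → + length (filter (λ x → φ x ≟ y) xs) ℤ.* g y) ∎

  -- Every fibre is a singleton, so all multiplicities in `∑-fibre` are 1. The bijections between
  -- finite sets used below enter through this lemma or through `length-reindex`.
  ∑-reindex : (φ : A → B) (g : B → ℤ) {xs : List A} {ys : List B} → Unique xs → Unique ys →
              (∀ {x} → x ∈ xs → φ x ∈ ys) →
              (∀ {x y} → x ∈ xs → y ∈ xs → φ x ≡ φ y → x ≡ y) →
              (∀ {y} → y ∈ ys → ∃ λ x → x ∈ xs × φ x ≡ y) →
              ∑ xs (g ∘ φ) ≡ ∑ ys g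
  ∑-reindex φ g {xs} {ys} xs! ys! φ∈ injective surjective =
    trans (∑-fibre φ g ys! φ∈) (∑-cong ys λ {y} y∈ys → trans
      (cong (λ k → + k ℤ.* g y) (fibre y∈ys)) (ℤ.*-identityˡ (g y)))
    where
    fibre : ∀ {y} → y ∈ ys → length (filter (λ x → φ x ≟ y) xs) ≡ 1
    fibre {y} y∈ys with x , x∈xs , refl ← surjective y∈ys =
      cong length (filter-! (λ x → φ x ≟ y) xs! x∈xs refl λ x′∈xs φx′≡φx →
        injective x′∈xs x∈xs φx′≡φx)

  length-reindex : (φ : A → B) {xs : List A} {ys : List B} → Unique xs → Unique ys →
                   (∀ {x} → x ∈ xs → φ x ∈ ys) →
                   (∀ {x y} → x ∈ xs → y ∈ xs → φ x ≡ φ y → x ≡ y) →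
                   (∀ {y} → y ∈ ys → ∃ λ x → x ∈ xs × φ x ≡ y) →
                   length xs ≡ length ys
  length-reindex φ {xs} {ys} xs! ys! φ∈ injective surjective = ℤ.+-injective (begin
    + length xs          ≡⟨ ∑-1 xs ⟨
    ∑ xs (const 1ℤ)      ≡⟨ ∑-reindex φ (const 1ℤ) xs! ys! φ∈ injective surjective ⟩
    ∑ ys (const 1ℤ)      ≡⟨ ∑-1 ys ⟩
    + length ys          ∎)

-- Divisors and Möbius inversion

-- The range starts at 0 so that the summation variable is the divisor itself, not the shifted
-- `suc k` of `_∗_`; for `n ≥ 1` the entry 0 is filtered out.
divisors : ℕ → List ℕ
divisors n = filter (_∣? n) (upTo (suc n))

divisors-! : ∀ n → Unique (divisors n)
divisors-! n = filter⁺ (_∣? n) (upTo⁺ (suc n))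

∈-divisors⁺ : ∀ {d n} .{{_ : NonZero n}} → d ∣ n → d ∈ divisors n
∈-divisors⁺ {n = n} d∣n = ∈-filter⁺ (_∣? n) (∈-upTo⁺ (s≤s (∣⇒≤ d∣n))) d∣n

∈-divisors⁻ : ∀ {d} n → d ∈ divisors n → d ∣ n
∈-divisors⁻ n d∈ = proj₂ (∈-filter⁻ (_∣? n) {xs = upTo (suc n)} d∈)

-- Total, because a summation variable comes without a NonZero instance.
infixl 7 _÷_
_÷_ : ℕ → ℕ → ℕ
n ÷ zero    = 0
n ÷ d@(suc _) = n ℕ./ d

*-÷ : ∀ {d n} → d ∣ n → d * (n ÷ d) ≡ n
*-÷ {zero}  0∣n = sym (0∣⇒≡0 0∣n)
*-÷ {suc _} d∣n = m*[n/m]≡n d∣n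

÷-∣ : ∀ {d n} → d ∣ n → n ÷ d ∣ n
÷-∣ {d} d∣n = divides d (sym (*-÷ d∣n))

*-÷-cancel : ∀ d {n} .{{_ : NonZero d}} → (d * n) ÷ d ≡ n
*-÷-cancel d@(suc _) {n} = trans (/-congˡ {o = d} (*-comm d n)) (m*n/n≡m n d)

∣-nonZero : ∀ {d n} .{{_ : NonZero n}} → d ∣ n → NonZero d
∣-nonZero {zero}  {n} 0∣n = contradiction (0∣⇒≡0 0∣n) (≢-nonZero⁻¹ n)
∣-nonZero {suc _}     _   = _

∗-divisors : ∀ f g n .{{_ : NonZero n}} → (f ∗ g) n ≡ ∑ (divisors n) (λ d → f d ℤ.* g (n ÷ d))
∗-divisors f g n = ∑-reindex _≟_ suc (λ d → f d ℤ.* g (n ÷ d))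
  (filter⁺ (λ k → suc k ∣? n) (upTo⁺ n)) (divisors-! n)
  (λ k∈ → ∈-divisors⁺ (proj₂ (∈-filter⁻ (λ k → suc k ∣? n) {xs = upTo n} k∈)))
  (λ _ _ → suc-injective)
  (surjective ∘ ∈-divisors⁻ n)
  where
  surjective : ∀ {d} → d ∣ n → ∃ λ k → k ∈ filter (λ k → suc k ∣? n) (upTo n) × suc k ≡ d
  surjective {zero}  0∣n = contradiction (0∣⇒≡0 0∣n) (≢-nonZero⁻¹ n)
  surjective {suc k} d∣n = k , ∈-filter⁺ (λ k → suc k ∣? n) (∈-upTo⁺ (∣⇒≤ d∣n)) d∣n , refl

-- The Möbius function and its divisor sums

squarefreeSign : List ℕ → ℤ
squarefreeSign ps = if does (unique? _≟_ ps) then -1ℤ ℤ.^ length ps else 0ℤ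

squarefreeSign-↭ : ∀ {ps qs} → ps ↭ qs → squarefreeSign ps ≡ squarefreeSign qs
squarefreeSign-↭ {ps} {qs} ps↭qs = cong₂ (λ b k → if b then -1ℤ ℤ.^ k else 0ℤ)
  (does-⇔ (mk⇔ (Unique-resp-↭ (setoid ℕ) (↭⇒↭ₛ ps↭qs)) (Unique-resp-↭ (setoid ℕ) (↭⇒↭ₛ (↭-sym ps↭qs))))
          (unique? _≟_ ps) (unique? _≟_ qs))
  (↭-length ps↭qs)

-- `μ` is computed from the list that `factorise` returns. Uniqueness up to permutation allows any
-- other factorisation, such as one of `p * n` built from that of `n`.
μ-factors : ∀ {n} .{{_ : NonZero n}} (ps : PrimeFactorisation n) → μ n ≡ squarefreeSign (factors ps)
μ-factors {n@(suc _)} ps = squarefreeSign-↭ (factorisationUnique (factorise n) ps)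

module _ {p} (p-prime : Prime p) (n : ℕ) .{{_ : NonZero n}} where

  private
    instance
      p≢0 : NonZero p
      p≢0 = prime⇒nonZero p-prime

      pn≢0 : NonZero (p * n)
      pn≢0 = m*n≢0 p n

    open PrimeFactorisation (factorise n) using (isFactorisation; factorsPrime)

    ps = factors (factorise n)

    factorisation : PrimeFactorisation (p * n)
    factorisation = record
      { factors         = p ∷ ps
      ; isFactorisation = cong (p *_) isFactorisation
      ; factorsPrime    = p-prime ∷ factorsPrime
      }

  μ-prime-∣ : p ∣ n → μ (p * n) ≡ 0ℤ
  μ-prime-∣ p∣n = begin
    μ (p * n)                ≡⟨ μ-factors factorisation ⟩
    squarefreeSign (p ∷ ps)  ≡⟨ cong (if_then _ else 0ℤ) (dec-false (unique? _≟_ (p ∷ ps)) repeated) ⟩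
    0ℤ                       ∎
    where
    repeated : ¬ Unique (p ∷ ps)
    repeated (p∉ps ∷ _) = All.lookup p∉ps
      (factorisationHasAllPrimeFactors p-prime (subst (p ∣_) isFactorisation p∣n) factorsPrime) refl

  μ-prime-∤ : p ∤ n → μ (p * n) ≡ ℤ.- μ n
  μ-prime-∤ p∤n = begin
    μ (p * n)                ≡⟨ μ-factors factorisation ⟩
    squarefreeSign (p ∷ ps)
      ≡⟨ cong (if_then _ else 0ℤ) (does-⇔ (mk⇔ tail cons) (unique? _≟_ (p ∷ ps)) (unique? _≟_ ps)) ⟩
    (if does (unique? _≟_ ps) then -1ℤ ℤ.* -1ℤ ℤ.^ length ps else 0ℤ)
      ≡⟨ negate (does (unique? _≟_ ps)) ⟩
    ℤ.- squarefreeSign ps    ≡⟨ cong ℤ.-_ (μ-factors (factorise n)) ⟨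
    ℤ.- μ n                  ∎
    where
    tail : Unique (p ∷ ps) → Unique ps
    tail (_ ∷ ps!) = ps!

    cons : Unique ps → Unique (p ∷ ps)
    cons ps! = All.tabulate
      (λ { q∈ps refl → p∤n (subst (p ∣_) (sym isFactorisation) (∈⇒∣product q∈ps)) }) ∷ ps!

    negate : ∀ b {x} → (if b then -1ℤ ℤ.* x else 0ℤ) ≡ ℤ.- (if b then x else 0ℤ)
    negate true  = ℤ.-1*i≡-i _
    negate false = refl

∃prime∣ : ∀ n .{{_ : NonTrivial n}} → ∃ λ p → Prime p × p ∣ n
∃prime∣ n@(2+ _) with factorise n
... | record { factors = p ∷ ps ; isFactorisation = eq ; factorsPrime = p-prime ∷ _ } =
  p , p-prime , divides (product ps) (trans eq (*-comm p _))

prime∤⇒coprime : ∀ {p n} → Prime p → p ∤ n → Coprime n p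
prime∤⇒coprime p-prime p∤n (d∣n , d∣p) with prime⇒irreducible p-prime d∣p
... | inj₁ d≡1  = d≡1
... | inj₂ refl = contradiction d∣n p∤n

-- With p ∣ n prime, the divisors divisible by p cancel against the others.
∑μ≡0 : ∀ n .{{_ : NonZero n}} .{{_ : NonTrivial n}} → ∑ (divisors n) μ ≡ 0ℤ
∑μ≡0 n with p , p-prime , divides m refl ← ∃prime∣ n = begin
  ∑ (divisors n) μ
    ≡⟨ ∑-split (p ∣?_) μ (divisors n) ⟩
  ∑ (filter (p ∣?_) (divisors n)) μ ℤ.+ ∑ (p∤divisors n) μ
    ≡⟨ cong₂ ℤ._+_ (sym multiples) nonMultiples ⟩
  ∑ (divisors m) (λ d → μ (p * d)) ℤ.+ ∑ (p∤divisors m) μ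
    ≡⟨ cong (λ s → s ℤ.+ ∑ (p∤divisors m) μ) signs ⟩
  ∑ (p∤divisors m) (ℤ.-_ ∘ μ) ℤ.+ ∑ (p∤divisors m) μ
    ≡⟨ ∑-+ (p∤divisors m) (ℤ.-_ ∘ μ) μ ⟨
  ∑ (p∤divisors m) (λ d → ℤ.- μ d ℤ.+ μ d)
    ≡⟨ ∑-cong (p∤divisors m) (λ {d} _ → ℤ.+-inverseˡ (μ d)) ⟩
  ∑ (p∤divisors m) (const 0ℤ)
    ≡⟨ ∑-zero (p∤divisors m) ⟩
  0ℤ ∎
  where
  p∤divisors : ℕ → List ℕ
  p∤divisors k = filter (λ d → ¬? (p ∣? d)) (divisors k)

  instance
    m≢0 : NonZero m
    m≢0 = m*n≢0⇒m≢0 m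

    p≢0 : NonZero p
    p≢0 = prime⇒nonZero p-prime

  ∈-p∣⁻ : ∀ {d} → d ∈ filter (p ∣?_) (divisors n) → d ∣ n × p ∣ d
  ∈-p∣⁻ d∈ with d∈n , p∣d ← ∈-filter⁻ (p ∣?_) {xs = divisors n} d∈ = ∈-divisors⁻ n d∈n , p∣d

  ∈-p∤⁻ : ∀ {d} k → d ∈ p∤divisors k → d ∣ k × p ∤ d
  ∈-p∤⁻ k d∈ with d∈k , p∤d ← ∈-filter⁻ (λ d → ¬? (p ∣? d)) {xs = divisors k} d∈ =
    ∈-divisors⁻ k d∈k , p∤d

  ∈-p∤⁺ : ∀ {d} k .{{_ : NonZero k}} → d ∣ k → p ∤ d → d ∈ p∤divisors k
  ∈-p∤⁺ k d∣k p∤d = ∈-filter⁺ (λ d → ¬? (p ∣? d)) (∈-divisors⁺ d∣k) p∤d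

  multiples : ∑ (divisors m) (λ d → μ (p * d)) ≡ ∑ (filter (p ∣?_) (divisors n)) μ
  multiples = ∑-reindex _≟_ (p *_) μ (divisors-! m) (filter⁺ (p ∣?_) (divisors-! n))
    (λ {d} d∈ → ∈-filter⁺ (p ∣?_)
      (∈-divisors⁺ (subst (_∣ n) (*-comm d p) (*-monoˡ-∣ {m = d} {n = m} p (∈-divisors⁻ m d∈)))) (m∣m*n d))
    (λ {d} {e} _ _ → *-cancelˡ-≡ d e p)
    (λ d∈ → surjective (∈-p∣⁻ d∈))
    where
    surjective : ∀ {d} → d ∣ n × p ∣ d → ∃ λ e → e ∈ divisors m × p * e ≡ d
    surjective (d∣n , divides e refl) = e , ∈-divisors⁺ (*-cancelʳ-∣ {e} {m} p d∣n) , *-comm p e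

  -- A divisor of `n = m * p` that `p` does not divide is coprime to `p`, hence divides `m`.
  nonMultiples : ∑ (p∤divisors n) μ ≡ ∑ (p∤divisors m) μ
  nonMultiples = ∑-reindex _≟_ id μ
    (filter⁺ (λ d → ¬? (p ∣? d)) (divisors-! n)) (filter⁺ (λ d → ¬? (p ∣? d)) (divisors-! m))
    (λ {d} d∈ → let d∣n , p∤d = ∈-p∤⁻ n d∈ in
      ∈-p∤⁺ m (coprime-divisor (prime∤⇒coprime p-prime p∤d) (subst (d ∣_) (*-comm m p) d∣n)) p∤d)
    (λ _ _ → id)
    (λ d∈ → let d∣m , p∤d = ∈-p∤⁻ m d∈ in _ , ∈-p∤⁺ n (∣m⇒∣m*n p d∣m) p∤d , refl)

  -- If `p` divides `d`, then `p * d` has a repeated prime and its term vanishes; otherwise the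
  -- additional prime flips the sign.
  signs : ∑ (divisors m) (λ d → μ (p * d)) ≡ ∑ (p∤divisors m) (ℤ.-_ ∘ μ)
  signs = begin
    ∑ (divisors m) (λ d → μ (p * d))
      ≡⟨ ∑-split (p ∣?_) _ (divisors m) ⟩
    ∑ (filter (p ∣?_) (divisors m)) (λ d → μ (p * d)) ℤ.+ ∑ (p∤divisors m) (λ d → μ (p * d))
      ≡⟨ cong₂ ℤ._+_ (trans (∑-cong p∣ds vanish) (∑-zero p∣ds)) (∑-cong (p∤divisors m) negate) ⟩
    0ℤ ℤ.+ ∑ (p∤divisors m) (ℤ.-_ ∘ μ)
      ≡⟨ ℤ.+-identityˡ _ ⟩
    ∑ (p∤divisors m) (ℤ.-_ ∘ μ) ∎
    where
    p∣ds = filter (p ∣?_) (divisors m)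

    vanish : ∀ {d} → d ∈ filter (p ∣?_) (divisors m) → μ (p * d) ≡ 0ℤ
    vanish {d} d∈ with d∈m , p∣d ← ∈-filter⁻ (p ∣?_) {xs = divisors m} d∈ =
      μ-prime-∣ p-prime d {{∣-nonZero (∈-divisors⁻ m d∈m)}} p∣d

    negate : ∀ {d} → d ∈ p∤divisors m → μ (p * d) ≡ ℤ.- μ d
    negate {d} d∈ with d∣m , p∤d ← ∈-p∤⁻ m d∈ = μ-prime-∤ p-prime d {{∣-nonZero d∣m}} p∤d

∑μ : ∀ n .{{_ : NonZero n}} → ∑ (divisors n) μ ≡ 𝟙 (n ≟ 1)
∑μ 1          = refl
∑μ n@(2+ _) = ∑μ≡0 n

-- With `n = e * k * c`, the involution `d ↦ n ÷ d` sends the multiple `e * k` of `e` to the divisor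
-- `c` of `n ÷ e`.
∑-codivisors : ∀ (f : ℕ → ℤ) {e n} .{{_ : NonZero n}} → e ∣ n →
               ∑ (filter (e ∣?_) (divisors n)) (λ d → f (n ÷ d)) ≡ ∑ (divisors (n ÷ e)) f
∑-codivisors f {e} {n} e∣n = ∑-reindex _≟_ (n ÷_) f
  (filter⁺ (e ∣?_) (divisors-! n)) (divisors-! (n ÷ e))
  (λ d∈ → codivisor (∈⁻ d∈)) (λ d∈ d′∈ → injective (proj₁ (∈⁻ d∈)) (proj₁ (∈⁻ d′∈)))
  (surjective ∘ ∈-divisors⁻ (n ÷ e))
  where
  instance
    e≢0 : NonZero e
    e≢0 = ∣-nonZero e∣n

    n÷e≢0 : NonZero (n ÷ e)
    n÷e≢0 = ∣-nonZero (÷-∣ e∣n)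

  ∈⁻ : ∀ {d} → d ∈ filter (e ∣?_) (divisors n) → d ∣ n × e ∣ d
  ∈⁻ d∈ with d∈n , e∣d ← ∈-filter⁻ (e ∣?_) {xs = divisors n} d∈ = ∈-divisors⁻ n d∈n , e∣d

  codivisor : ∀ {d} → d ∣ n × e ∣ d → n ÷ d ∈ divisors (n ÷ e)
  codivisor {d} (d∣n , divides k refl) = ∈-divisors⁺ (divides k (*-cancelˡ-≡ (n ÷ e) _ e (begin
    e * (n ÷ e)        ≡⟨ *-÷ e∣n ⟩
    n                  ≡⟨ *-÷ d∣n ⟨
    k * e * (n ÷ d)    ≡⟨ cong (_* (n ÷ d)) (*-comm k e) ⟩
    e * k * (n ÷ d)    ≡⟨ *-assoc e k (n ÷ d) ⟩
    e * (k * (n ÷ d))  ∎)))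

  injective : ∀ {d d′} → d ∣ n → d′ ∣ n → n ÷ d ≡ n ÷ d′ → d ≡ d′
  injective {d} {d′} d∣n d′∣n eq = *-cancelʳ-≡ d d′ (n ÷ d) {{∣-nonZero (÷-∣ d∣n)}}
    (trans (*-÷ d∣n) (trans (sym (*-÷ d′∣n)) (cong (d′ *_) (sym eq))))

  surjective : ∀ {c} → c ∣ n ÷ e → ∃ λ d → d ∈ filter (e ∣?_) (divisors n) × n ÷ d ≡ c
  surjective {c} (divides k eq) =
    e * k ,
    ∈-filter⁺ (e ∣?_) (∈-divisors⁺ (divides c (trans n≡ (*-comm (e * k) c)))) (m∣m*n k) ,
    trans (cong (_÷ (e * k)) n≡) (*-÷-cancel (e * k) {{ek≢0}})
    where
    n≡ : n ≡ e * k * c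
    n≡ = begin
      n            ≡⟨ *-÷ e∣n ⟨
      e * (n ÷ e)  ≡⟨ cong (e *_) eq ⟩
      e * (k * c)  ≡⟨ *-assoc e k c ⟨
      e * k * c    ∎

    ek≢0 : NonZero (e * k)
    ek≢0 = ∣-nonZero (divides c (trans n≡ (*-comm (e * k) c)))

-- All pairs of divisors of `n` are summed with the indicator of `e ∣ d`, so that the order of
-- summation can be exchanged freely. The coefficient of `g e` is then the sum of `μ` over the
-- divisors of `n ÷ e`, which vanishes unless `e` is `n`.
möbius-inversion : (f g : ℕ → ℤ) → (∀ n .{{_ : NonZero n}} → f n ≡ ∑ (divisors n) g) →
                   ∀ n .{{_ : NonZero n}} → (f ∗ μ) n ≡ g n
möbius-inversion f g f≡∑g n = begin
  (f ∗ μ) n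
    ≡⟨ ∗-divisors f μ n ⟩
  ∑ ds (λ d → f d ℤ.* μ (n ÷ d))
    ≡⟨ ∑-cong ds expand ⟩
  ∑ ds (λ d → ∑ ds (λ e → 𝟙 (e ∣? d) ℤ.* g e ℤ.* μ (n ÷ d)))
    ≡⟨ ∑-swap ds ds _ ⟩
  ∑ ds (λ e → ∑ ds (λ d → 𝟙 (e ∣? d) ℤ.* g e ℤ.* μ (n ÷ d)))
    ≡⟨ ∑-cong ds collapse ⟩
  ∑ ds (λ e → 𝟙 (n ≟ e) ℤ.* g e)
    ≡⟨ ∑-pick _≟_ g (divisors-! n) (∈-divisors⁺ ∣-refl) ⟩
  g n ∎
  where
  ds = divisors n

  expand : ∀ {d} → d ∈ ds → f d ℤ.* μ (n ÷ d) ≡ ∑ ds (λ e → 𝟙 (e ∣? d) ℤ.* g e ℤ.* μ (n ÷ d))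
  expand {d} d∈ = begin
    f d ℤ.* μ (n ÷ d)
      ≡⟨ cong (ℤ._* μ (n ÷ d)) (begin
           f d                              ≡⟨ f≡∑g d ⟩
           ∑ (divisors d) g                 ≡⟨ enlarge ⟩
           ∑ (filter (_∣? d) ds) g          ≡⟨ ∑-filter (_∣? d) g ds ⟩
           ∑ ds (λ e → 𝟙 (e ∣? d) ℤ.* g e)  ∎) ⟩
    ∑ ds (λ e → 𝟙 (e ∣? d) ℤ.* g e) ℤ.* μ (n ÷ d)
      ≡⟨ ∑-*ʳ ds _ (μ (n ÷ d)) ⟨
    ∑ ds (λ e → 𝟙 (e ∣? d) ℤ.* g e ℤ.* μ (n ÷ d)) ∎
    where
    d∣n = ∈-divisors⁻ n d∈

    instance
      d≢0 : NonZero d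
      d≢0 = ∣-nonZero d∣n

    enlarge : ∑ (divisors d) g ≡ ∑ (filter (_∣? d) ds) g
    enlarge = ∑-reindex _≟_ id g (divisors-! d) (filter⁺ (_∣? d) (divisors-! n))
      (λ e∈ → let e∣d = ∈-divisors⁻ d e∈ in ∈-filter⁺ (_∣? d) (∈-divisors⁺ (∣-trans e∣d d∣n)) e∣d)
      (λ _ _ → id)
      (λ e∈ → _ , ∈-divisors⁺ (proj₂ (∈-filter⁻ (_∣? d) {xs = ds} e∈)) , refl)

  collapse : ∀ {e} → e ∈ ds → ∑ ds (λ d → 𝟙 (e ∣? d) ℤ.* g e ℤ.* μ (n ÷ d)) ≡ 𝟙 (n ≟ e) ℤ.* g e
  collapse {e} e∈ = begin
    ∑ ds (λ d → 𝟙 (e ∣? d) ℤ.* g e ℤ.* μ (n ÷ d))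
      ≡⟨ ∑-cong ds (λ {d} _ → ℤ*.xy∙z≈xz∙y (𝟙 (e ∣? d)) (g e) (μ (n ÷ d))) ⟩
    ∑ ds (λ d → 𝟙 (e ∣? d) ℤ.* μ (n ÷ d) ℤ.* g e)
      ≡⟨ ∑-*ʳ ds _ (g e) ⟩
    ∑ ds (λ d → 𝟙 (e ∣? d) ℤ.* μ (n ÷ d)) ℤ.* g e
      ≡⟨ cong (ℤ._* g e) (begin
           ∑ ds (λ d → 𝟙 (e ∣? d) ℤ.* μ (n ÷ d))    ≡⟨ ∑-filter (e ∣?_) (λ d → μ (n ÷ d)) ds ⟨
           ∑ (filter (e ∣?_) ds) (λ d → μ (n ÷ d))  ≡⟨ ∑-codivisors μ e∣n ⟩
           ∑ (divisors (n ÷ e)) μ                   ≡⟨ ∑μ (n ÷ e) {{∣-nonZero (÷-∣ e∣n)}} ⟩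
           𝟙 (n ÷ e ≟ 1)
             ≡⟨ cong (if_then 1ℤ else 0ℤ) (does-⇔ (mk⇔ ÷≡1⇒≡ ≡⇒÷≡1) (n ÷ e ≟ 1) (n ≟ e)) ⟩
           𝟙 (n ≟ e)                                ∎) ⟩
    𝟙 (n ≟ e) ℤ.* g e ∎
    where
    e∣n = ∈-divisors⁻ n e∈

    ÷≡1⇒≡ : n ÷ e ≡ 1 → n ≡ e
    ÷≡1⇒≡ eq = trans (sym (*-÷ e∣n)) (trans (cong (e *_) eq) (*-identityʳ e))

    ≡⇒÷≡1 : n ≡ e → n ÷ e ≡ 1
    ≡⇒÷≡1 refl = trans (cong (_÷ n) (sym (*-identityʳ n))) (*-÷-cancel n)

-- Counting by closed walks

toℕ-mod : ∀ j n .{{_ : NonZero n}} → toℕ (j mod n) ≡ j % n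
toℕ-mod j n = toℕ-fromℕ< (m%n<n j n)

mod-cong : ∀ i j n .{{_ : NonZero n}} → i % n ≡ j % n → i mod n ≡ j mod n
mod-cong i j n eq = toℕ-injective (trans (toℕ-mod i n) (trans eq (sym (toℕ-mod j n))))

toℕ-mod-id : .{{_ : NonZero n}} (i : Fin n) → toℕ i mod n ≡ i
toℕ-mod-id {n} i = toℕ-injective (trans (toℕ-mod (toℕ i) n) (m<n⇒m%n≡m (toℕ<n i)))

+-%-cong : ∀ k i j n .{{_ : NonZero n}} → i % n ≡ j % n → (k + i) % n ≡ (k + j) % n
+-%-cong k i j n eq = begin
  (k + i) % n          ≡⟨ %-distribˡ-+ k i n ⟩
  (k % n + i % n) % n  ≡⟨ cong (λ l → (k % n + l) % n) eq ⟩
  (k % n + j % n) % n  ≡⟨ %-distribˡ-+ k j n ⟨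
  (k + j) % n          ∎

next-mod : ∀ j n .{{_ : NonZero n}} → next (j mod n) ≡ suc j mod n
next-mod j n@(suc _) = mod-cong (suc (toℕ (j mod n))) (suc j) n
  (+-%-cong 1 (toℕ (j mod n)) j n (trans (cong (_% n) (toℕ-mod j n)) (m%n%n≡m%n j n)))

-- The n-periodic indicator sequence of X ⊆ ℤₙ.
ext : .{{_ : NonZero n}} → Subset n → ℕ → Bool
ext {n} X j = lookup X (j mod n)

Periodic : (ℕ → Bool) → ℕ → Set
Periodic f k = ∀ j → f (k + j) ≡ f j

ext-toℕ : .{{_ : NonZero n}} (X : Subset n) (i : Fin n) → ext X (toℕ i) ≡ lookup X i
ext-toℕ X i = cong (lookup X) (toℕ-mod-id i)

ext-periodic : .{{_ : NonZero n}} (X : Subset n) → Periodic (ext X) n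
ext-periodic {n} X j = cong (lookup X) (mod-cong _ _ n (trans (cong (_% n) (+-comm n j)) ([m+n]%n≡m%n j n)))

-- Independence and domination at one position, in terms of three consecutive values; the pair `b c`
-- is left to the next window.
Window : Bool → Bool → Bool → Set
Window a b c = ¬ (a ≡ true × b ≡ true) × (a ≡ true ⊎ b ≡ true ⊎ c ≡ true)

window? : ∀ a b c → Dec (Window a b c)
window? a b c = ¬? ((a ≟ᵇ true) ×-dec (b ≟ᵇ true)) ×-dec ((a ≟ᵇ true) ⊎-dec (b ≟ᵇ true) ⊎-dec (c ≟ᵇ true))

WindowAt : (ℕ → Bool) → ℕ → Set
WindowAt f j = Window (f j) (f (1 + j)) (f (2 + j))

MIS⇒windows : .{{_ : NonZero n}} (X : Subset n) → IsMIS X → ∀ j → WindowAt (ext X) j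
MIS⇒windows {n} X (independent , dominating) j =
  (λ (x₀ , x₁) → independent (j mod n , member x₀ , subst (_∈ˢ X) (sym (next-mod j n)) (member x₁))) ,
  Sum.map (λ m → []=⇒lookup m)
    (Sum.map (λ m → []=⇒lookup (subst (_∈ˢ X) (next-mod j n) m))
             (λ m → []=⇒lookup (subst (_∈ˢ X) (trans (cong next (next-mod j n)) (next-mod (suc j) n)) m)))
    (dominating (j mod n))
  where
  member : ∀ {j} → ext X j ≡ true → (j mod n) ∈ˢ X
  member {j} = lookup⇒[]= (j mod n) X

windows⇒MIS : .{{_ : NonZero n}} (X : Subset n) → (∀ j → j < n → WindowAt (ext X) j) → IsMIS X
windows⇒MIS {n} X windows =
  (λ (i , i∈X , i′∈X) → proj₁ (windows (toℕ i) (toℕ<n i))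
    ( []=⇒lookup (subst (_∈ˢ X) (sym (toℕ-mod-id i)) i∈X)
    , []=⇒lookup (subst (_∈ˢ X) (sym (mod-next i)) i′∈X))) ,
  λ i → Sum.map (λ x₀ → subst (_∈ˢ X) (toℕ-mod-id i) (member x₀))
    (Sum.map (λ x₁ → subst (_∈ˢ X) (mod-next i) (member x₁))
             (λ x₂ → subst (_∈ˢ X)
               (trans (sym (next-mod (suc (toℕ i)) n)) (cong next (mod-next i))) (member x₂)))
    (proj₂ (windows (toℕ i) (toℕ<n i)))
  where
  member : ∀ {j} → ext X j ≡ true → (j mod n) ∈ˢ X
  member {j} = lookup⇒[]= (j mod n) X

  mod-next : ∀ i → suc (toℕ i) mod n ≡ next i
  mod-next i = trans (sym (next-mod (toℕ i) n)) (cong next (toℕ-mod-id i))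

-- Every window of the word a b xs c d is admissible. A cyclic word a b xs is
-- unrolled to a b xs a b.
Windows : ∀ {m} → Bool → Bool → Vec Bool m → Bool → Bool → Set
Windows a b []       c d = Window a b c × Window b c d
Windows a b (x ∷ xs) c d = Window a b x × Windows b x xs c d

windows? : ∀ {m} a b (xs : Vec Bool m) c d → Dec (Windows a b xs c d)
windows? a b []       c d = window? a b c ×-dec window? b c d
windows? a b (x ∷ xs) c d = window? a b x ×-dec windows? b x xs c d

-- A word of `m + 4` letters has `m + 2` windows, one for each starting point in a period of length
-- `m + 2`. The induction shifts `f`.
Windows-tabulate : ∀ m (f : ℕ → Bool) →
  Windows (f 0) (f 1) (tabulate {n = m} λ i → f (2 + toℕ i)) (f (2 + m)) (f (3 + m)) ⇔
  (∀ j → j < 2 + m → WindowAt f j)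
Windows-tabulate zero f = mk⇔
  (λ { (w₀ , w₁) 0 _ → w₀ ; (w₀ , w₁) 1 _ → w₁ ; _ (2+ _) (s≤s (s≤s ())) })
  (λ w → w 0 (s≤s z≤n) , w 1 (s≤s (s≤s z≤n)))
Windows-tabulate (suc m) f = mk⇔
  (λ { (w , ws) zero _ → w ; (w , ws) (suc j) (s≤s j<) → to (Windows-tabulate m (f ∘ suc)) ws j j< })
  (λ w → w 0 (s≤s z≤n) , from (Windows-tabulate m (f ∘ suc)) (λ j j< → w (suc j) (s≤s j<)))

MIS⇔Windows : ∀ {m} a b (xs : Vec Bool m) → IsMIS (a ∷ b ∷ xs) ⇔ Windows a b xs a b
MIS⇔Windows {m} a b xs = mk⇔
  (λ mis → subst id linear (from (Windows-tabulate m f) (λ j _ → MIS⇒windows X mis j)))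
  (λ ws → windows⇒MIS X (to (Windows-tabulate m f) (subst id (sym linear) ws)))
  where
  X = a ∷ b ∷ xs
  f = ext X

  xs≡ : tabulate (λ i → f (2 + toℕ i)) ≡ xs
  xs≡ = trans (tabulate-cong λ i → ext-toℕ X (Fin.suc (Fin.suc i))) (tabulate∘lookup xs)

  wrap : ∀ j → f (j + (2 + m)) ≡ f j
  wrap j = trans (cong f (+-comm j (2 + m))) (ext-periodic X j)

  -- `Windows` is a type computed from the word, so equal words give equal types; the letters
  -- `f (2 + m)` and `f (3 + m)` wrap around to `a` and `b`.
  linear : Windows a b (tabulate λ i → f (2 + toℕ i)) (f (2 + m)) (f (3 + m)) ≡ Windows a b xs a b
  linear = trans (cong₂ (Windows a b (tabulate λ i → f (2 + toℕ i))) (wrap 0) (wrap 1))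
                 (cong (λ xs → Windows a b xs a b) xs≡)

∑-subsets : ∀ m (f : Subset (suc m) → ℤ) →
  ∑ (subsets (suc m)) f ≡ ∑ (subsets m) (f ∘ (true ∷_)) ℤ.+ ∑ (subsets m) (f ∘ (false ∷_))
∑-subsets m f = begin
  ∑ (subsets (suc m)) f
    ≡⟨ ∑-++ (map (true ∷_) (subsets m)) _ f ⟩
  ∑ (map (true ∷_) (subsets m)) f ℤ.+ ∑ (map (false ∷_) (subsets m) ++ []) f
    ≡⟨ cong₂ ℤ._+_ (∑-map (true ∷_) f (subsets m))
         (trans (∑-++ (map (false ∷_) (subsets m)) [] f)
                (trans (ℤ.+-identityʳ _) (∑-map (false ∷_) f (subsets m)))) ⟩
  ∑ (subsets m) (f ∘ (true ∷_)) ℤ.+ ∑ (subsets m) (f ∘ (false ∷_)) ∎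

𝟙-× : {P Q : Set} (P? : Dec P) (Q? : Dec Q) → 𝟙 (P? ×-dec Q?) ≡ 𝟙 P? ℤ.* 𝟙 Q?
𝟙-× P? Q? with does P?
... | true  = sym (ℤ.*-identityˡ (𝟙 Q?))
... | false = refl

module _ (c d : Bool) where

  -- The entry from `a b` to `c d` in the power `m + 2` of the transfer matrix on pairs: the `m + 4`
  -- letters make `m + 2` steps, one per window.
  walks : Bool → Bool → ℕ → ℤ
  walks a b m = ∑ (subsets m) (λ xs → 𝟙 (windows? a b xs c d))

  walks-suc : ∀ a b m → walks a b (suc m) ≡
    𝟙 (window? a b true) ℤ.* walks b true m ℤ.+ 𝟙 (window? a b false) ℤ.* walks b false m
  walks-suc a b m = trans (∑-subsets m _) (cong₂ ℤ._+_ (step true) (step false))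
    where
    step : ∀ x → ∑ (subsets m) (λ xs → 𝟙 (windows? a b (x ∷ xs) c d)) ≡ 𝟙 (window? a b x) ℤ.* walks b x m
    step x = trans (∑-cong (subsets m) (λ {xs} _ → 𝟙-× (window? a b x) (windows? b x xs c d)))
                   (∑-*ˡ (𝟙 (window? a b x)) (subsets m) _)

  walks₁₁ : ∀ m → walks true true m ≡ 0ℤ
  walks₁₁ zero    = refl
  walks₁₁ (suc m) = walks-suc true true m

  walks₀₀ : ∀ m → walks false false (suc m) ≡ walks false true m
  walks₀₀ m = trans (walks-suc false false m) (trans (ℤ.+-identityʳ _) (ℤ.*-identityˡ _))

  walks₀₁ : ∀ m → walks false true (suc m) ≡ walks true false m
  walks₀₁ m = begin
    walks false true (suc m)                                ≡⟨ walks-suc false true m ⟩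
    1ℤ ℤ.* walks true true m ℤ.+ 1ℤ ℤ.* walks true false m
      ≡⟨ cong₂ (λ x y → 1ℤ ℤ.* x ℤ.+ y) (walks₁₁ m) (ℤ.*-identityˡ _) ⟩
    0ℤ ℤ.+ walks true false m                               ≡⟨ ℤ.+-identityˡ _ ⟩
    walks true false m                                      ∎

  walks₁₀ : ∀ m → walks true false (suc m) ≡ walks false true m ℤ.+ walks false false m
  walks₁₀ m = trans (walks-suc true false m)
    (cong₂ ℤ._+_ (ℤ.*-identityˡ (walks false true m)) (ℤ.*-identityˡ (walks false false m)))

  -- From 01 a walk must go to 10, and then reaches 01 again either at once or through 00. The
  -- return takes two or three steps, which gives the two terms.
  walks₀₁-perrin : ∀ m → walks false true (3 + m) ≡ walks false true (1 + m) ℤ.+ walks false true m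
  walks₀₁-perrin m = begin
    walks false true (3 + m)                              ≡⟨ walks₀₁ (2 + m) ⟩
    walks true false (2 + m)                              ≡⟨ walks₁₀ (1 + m) ⟩
    walks false true (1 + m) ℤ.+ walks false false (1 + m)
      ≡⟨ cong (λ x → walks false true (1 + m) ℤ.+ x) (walks₀₀ m) ⟩
    walks false true (1 + m) ℤ.+ walks false true m       ∎

  walks₁₀-perrin : ∀ m → walks true false (3 + m) ≡ walks true false (1 + m) ℤ.+ walks true false m
  walks₁₀-perrin m = begin
    walks true false (3 + m)                              ≡⟨ walks₀₁ (3 + m) ⟨
    walks false true (4 + m)                              ≡⟨ walks₀₁-perrin (1 + m) ⟩
    walks false true (2 + m) ℤ.+ walks false true (1 + m) ≡⟨ cong₂ ℤ._+_ (walks₀₁ (1 + m)) (walks₀₁ m) ⟩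
    walks true false (1 + m) ℤ.+ walks true false m       ∎

  walks₀₀-perrin : ∀ m → walks false false (3 + m) ≡ walks false false (1 + m) ℤ.+ walks false false m
  walks₀₀-perrin m = begin
    walks false false (3 + m)                             ≡⟨ walks₀₀ (2 + m) ⟩
    walks false true (2 + m)                              ≡⟨ walks₀₁ (1 + m) ⟩
    walks true false (1 + m)                              ≡⟨ walks₁₀ m ⟩
    walks false true m ℤ.+ walks false false m
      ≡⟨ cong (λ x → x ℤ.+ walks false false m) (walks₀₀ m) ⟨
    walks false false (1 + m) ℤ.+ walks false false m     ∎

-- The trace of that power; the state 11 has no admissible continuation and contributes nothing.
closedWalks : ℕ → ℤ
closedWalks m = walks true false true false m ℤ.+
               (walks false true false true m ℤ.+ walks false false false false m)

closedWalks-perrin : ∀ m → closedWalks (3 + m) ≡ closedWalks (1 + m) ℤ.+ closedWalks m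
closedWalks-perrin m = begin
  closedWalks (3 + m)
    ≡⟨ cong₂ ℤ._+_ (walks₁₀-perrin true false m)
         (cong₂ ℤ._+_ (walks₀₁-perrin false true m) (walks₀₀-perrin false false m)) ⟩
  a′ ℤ.+ a ℤ.+ (b′ ℤ.+ b ℤ.+ (c′ ℤ.+ c))
    ≡⟨ cong (λ x → a′ ℤ.+ a ℤ.+ x) (ℤ+.interchange b′ b c′ c) ⟩
  a′ ℤ.+ a ℤ.+ (b′ ℤ.+ c′ ℤ.+ (b ℤ.+ c))
    ≡⟨ ℤ+.interchange a′ a (b′ ℤ.+ c′) (b ℤ.+ c) ⟩
  closedWalks (1 + m) ℤ.+ closedWalks m ∎
  where
  a′ = walks true false true false (1 + m)
  a  = walks true false true false m
  b′ = walks false true false true (1 + m)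
  b  = walks false true false true m
  c′ = walks false false false false (1 + m)
  c  = walks false false false false m

closedWalks≡p : ∀ m → closedWalks m ≡ + p (2 + m)
-- Three initial values, at lengths 2, 3 and 4, since `closedWalks-perrin` first reaches length 5.
closedWalks≡p 0 = refl
closedWalks≡p 1 = refl
closedWalks≡p 2 = refl
closedWalks≡p (suc (suc (suc m))) =
  trans (closedWalks-perrin m) (cong₂ ℤ._+_ (closedWalks≡p (suc m)) (closedWalks≡p m))

∣𝐗∣≡p : ∀ n .{{_ : NonZero n}} → length (𝐗 n) ≡ p n
-- One letter is too short for the unrolled word. Here `next` fixes the only vertex, so independence
-- and domination contradict each other and `𝐗 1` is empty.
∣𝐗∣≡p 1               = refl
∣𝐗∣≡p (suc (suc m)) = ℤ.+-injective (begin
  + length (𝐗 (2 + m))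
    ≡⟨ ∑-𝟙 isMIS? (subsets (2 + m)) ⟨
  ∑ (subsets (2 + m)) (λ X → 𝟙 (isMIS? X))
    ≡⟨ ∑-subsets (suc m) _ ⟩
  _
    ≡⟨ cong₂ ℤ._+_ (∑-subsets m _) (∑-subsets m _) ⟩
  _
    ≡⟨ cong₂ ℤ._+_ (cong₂ ℤ._+_ (cyclic true true) (cyclic true false))
                   (cong₂ ℤ._+_ (cyclic false true) (cyclic false false)) ⟩
  walks true true true true m ℤ.+ walks true false true false m ℤ.+
    (walks false true false true m ℤ.+ walks false false false false m)
    ≡⟨ cong (λ x → x ℤ.+ (walks false true false true m ℤ.+ walks false false false false m))
         (trans (cong (λ x → x ℤ.+ walks true false true false m) (walks₁₁ true true m))
                (ℤ.+-identityˡ (walks true false true false m))) ⟩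
  closedWalks m
    ≡⟨ closedWalks≡p m ⟩
  + p (2 + m) ∎)
  where
  cyclic : ∀ a b → ∑ (subsets m) (λ xs → 𝟙 (isMIS? (a ∷ b ∷ xs))) ≡ walks a b a b m
  cyclic a b = ∑-cong (subsets m) λ {xs} _ → cong (if_then 1ℤ else 0ℤ)
    (does-⇔ (MIS⇔Windows a b xs) (isMIS? (a ∷ b ∷ xs)) (windows? a b xs a b))

-- Rotations and periods

toℕ-next : .{{_ : NonZero n}} (i : Fin n) → toℕ (next i) ≡ suc (toℕ i) % n
toℕ-next {n@(suc _)} i = toℕ-mod (suc (toℕ i)) n

-- Adding `m = n - 1` undoes `next` modulo `n`.
next-injective : {i j : Fin n} → next i ≡ next j → i ≡ j
next-injective {n@(suc m)} {i} {j} eq = toℕ-injective (begin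
  toℕ i                      ≡⟨ unwind i ⟨
  (m + suc (toℕ i)) % n      ≡⟨ +-%-cong m _ _ n (begin
    suc (toℕ i) % n            ≡⟨ toℕ-next i ⟨
    toℕ (next i)               ≡⟨ cong toℕ eq ⟩
    toℕ (next j)               ≡⟨ toℕ-next j ⟩
    suc (toℕ j) % n            ∎) ⟩
  (m + suc (toℕ j)) % n      ≡⟨ unwind j ⟩
  toℕ j                      ∎)
  where
  unwind : (i : Fin n) → (m + suc (toℕ i)) % n ≡ toℕ i
  unwind i = begin
    (m + suc (toℕ i)) % n  ≡⟨ cong (_% n) (trans (+-suc m (toℕ i)) (+-comm n (toℕ i))) ⟩
    (toℕ i + n) % n        ≡⟨ [m+n]%n≡m%n (toℕ i) n ⟩
    toℕ i % n              ≡⟨ m<n⇒m%n≡m (toℕ<n i) ⟩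
    toℕ i                  ∎

-- `σ` searches for a preimage of `next i`; by injectivity of `next` the only candidate is `i`.
lookup-σ : (X : Subset n) (i : Fin n) → lookup (σ X) (next i) ≡ lookup X i
lookup-σ X i = trans (lookup∘tabulate (λ j → does (image? j)) (next i)) (member (lookup X i) refl)
  where
  image? : ∀ j → Dec (∃ λ i → i ∈ˢ X × next i ≡ j)
  image? j = any? λ i → (i ∈? X) ×-dec (next i ≟ᶠ j)

  member : ∀ b → lookup X i ≡ b → does (image? (next i)) ≡ b
  member true  eq = dec-true (image? (next i)) (i , lookup⇒[]= i X eq , refl)
  member false eq = dec-false (image? (next i)) λ (j , j∈X , eq′) →
    contradiction (trans (sym eq) (trans (cong (lookup X) (sym (next-injective eq′))) ([]=⇒lookup j∈X))) λ ()

ext-σ : .{{_ : NonZero n}} (X : Subset n) (j : ℕ) → ext (σ X) (suc j) ≡ ext X j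
ext-σ {n} X j = trans (cong (lookup (σ X)) (sym (next-mod j n))) (lookup-σ X (j mod n))

ext-injective : .{{_ : NonZero n}} {X Y : Subset n} → ext X ≗ ext Y → X ≡ Y
ext-injective {X = X} {Y} X≗Y = begin
  X                    ≡⟨ tabulate∘lookup X ⟨
  tabulate (lookup X)
    ≡⟨ tabulate-cong (λ i → trans (sym (ext-toℕ X i)) (trans (X≗Y (toℕ i)) (ext-toℕ Y i))) ⟩
  tabulate (lookup Y)  ≡⟨ tabulate∘lookup Y ⟩
  Y                    ∎

periodic-* : ∀ {f k} q → Periodic f k → Periodic f (q * k)
periodic-* zero            f-k j = refl
periodic-* {f} {k} (suc q) f-k j =
  trans (cong f (+-assoc k (q * k) j)) (trans (f-k (q * k + j)) (periodic-* q f-k j))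

periodic-% : ∀ {f k} .{{_ : NonZero k}} → Periodic f k → ∀ j → f (j % k) ≡ f j
periodic-% {f} {k} f-k j = begin
  f (j % k)                  ≡⟨ periodic-* (j ℕ./ k) f-k (j % k) ⟨
  f (j ℕ./ k * k + j % k)      ≡⟨ cong f (+-comm (j ℕ./ k * k) (j % k)) ⟩
  f (j % k + j ℕ./ k * k)      ≡⟨ cong f (m≡m%n+[m/n]*n j k) ⟨
  f j                        ∎

periodic-+-cancel : ∀ {f k l} → Periodic f k → Periodic f (k + l) → Periodic f l
periodic-+-cancel {f} {k} {l} f-k f-kl j = begin
  f (l + j)        ≡⟨ f-k (l + j) ⟨
  f (k + (l + j))  ≡⟨ cong f (+-assoc k l j) ⟨
  f (k + l + j)    ≡⟨ f-kl j ⟩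
  f j              ∎

periodic-cong : ∀ {f g k} → f ≗ g → Periodic f k → Periodic g k
periodic-cong f≗g f-k j = trans (sym (f≗g _)) (trans (f-k j) (f≗g j))

iterate-+ : (f : A → A) (x : A) (k l : ℕ) → iterate f x (k + l) ≡ iterate f (iterate f x k) l
iterate-+ f x zero    l = refl
iterate-+ f x (suc k) l = iterate-+ f (f x) k l

module _ .{{_ : NonZero n}} where

  ext-iterate : (X : Subset n) (k j : ℕ) → ext (iterate σ X k) (k + j) ≡ ext X j
  ext-iterate X zero    j = refl
  ext-iterate X (suc k) j = begin
    ext (iterate σ (σ X) k) (suc (k + j))  ≡⟨ cong (ext (iterate σ (σ X) k)) (+-suc k j) ⟨
    ext (iterate σ (σ X) k) (k + suc j)    ≡⟨ ext-iterate (σ X) k (suc j) ⟩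
    ext (σ X) (suc j)                      ≡⟨ ext-σ X j ⟩
    ext X j                                ∎

  -- k (n − 1) stands for −k modulo n.
  k+k*pred : ∀ k → k + k * pred n ≡ k * n
  k+k*pred k = trans (sym (*-suc k (pred n))) (cong (k *_) (suc-pred n))

  -- `ext-iterate` reads the rotated set only at positions of the form `k + j`; adding the period
  -- `k * n = k + k * pred n` brings every position into that form.
  ext-rotate : (X : Subset n) (k j : ℕ) → ext (iterate σ X k) j ≡ ext X (j + k * pred n)
  ext-rotate X k j = begin
    ext Y j                           ≡⟨ periodic-* k (ext-periodic Y) j ⟨
    ext Y (k * n + j)                 ≡⟨ cong (λ l → ext Y (l + j)) (k+k*pred k) ⟨
    ext Y (k + k * pred n + j)
      ≡⟨ cong (ext Y) (trans (+-assoc k _ j) (cong (λ l → k + l) (+-comm _ j))) ⟩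
    ext Y (k + (j + k * pred n))      ≡⟨ ext-iterate X k (j + k * pred n) ⟩
    ext X (j + k * pred n)            ∎
    where Y = iterate σ X k

  -- The rotation by `k` cancels on both sides. The case `k = 0` serves to decide periodicity;
  -- general `k` shows that exponents of equal rotations differ by a period.
  iterate≡⇒periodic : (X : Subset n) (k l : ℕ) → iterate σ X k ≡ iterate σ X (k + l) → Periodic (ext X) l
  iterate≡⇒periodic X k l eq j = begin
    ext X (l + j)                              ≡⟨ ext-iterate X k (l + j) ⟨
    ext (iterate σ X k) (k + (l + j))          ≡⟨ cong₂ ext eq (sym (+-assoc k l j)) ⟩
    ext (iterate σ X (k + l)) (k + l + j)      ≡⟨ ext-iterate X (k + l) j ⟩
    ext X j                                    ∎

  periodic⇒iterate≡ : (X : Subset n) {k : ℕ} → Periodic (ext X) k → iterate σ X k ≡ X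
  periodic⇒iterate≡ X {k} X-k = ext-injective λ j → begin
    ext (iterate σ X k) j          ≡⟨ ext-rotate X k j ⟩
    ext X (j + k * pred n)         ≡⟨ X-k (j + k * pred n) ⟨
    ext X (k + (j + k * pred n))
      ≡⟨ cong (ext X) (trans (cong (λ l → k + l) (+-comm j _)) (sym (+-assoc k _ j))) ⟩
    ext X (k + k * pred n + j)     ≡⟨ cong (λ l → ext X (l + j)) (k+k*pred k) ⟩
    ext X (k * n + j)              ≡⟨ periodic-* k (ext-periodic X) j ⟩
    ext X j                        ∎

  -- A condition on infinitely many positions is decided by one equation between subsets.
  periodic? : (X : Subset n) → Decidable (Periodic (ext X))
  periodic? X k = map′ (iterate≡⇒periodic X 0 k ∘ sym) (periodic⇒iterate≡ X) (iterate σ X k ≟ˢ X)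

  iterate-% : (X : Subset n) {d : ℕ} .{{_ : NonZero d}} → Periodic (ext X) d →
              ∀ k → iterate σ X (k % d) ≡ iterate σ X k
  iterate-% X {d} X-d k = begin
    iterate σ X (k % d)
      ≡⟨ cong (λ Y → iterate σ Y (k % d)) (periodic⇒iterate≡ X (periodic-* (k ℕ./ d) X-d)) ⟨
    iterate σ (iterate σ X (k ℕ./ d * d)) (k % d)  ≡⟨ iterate-+ σ X (k ℕ./ d * d) (k % d) ⟨
    iterate σ X (k ℕ./ d * d + k % d)              ≡⟨ cong (iterate σ X) (+-comm (k ℕ./ d * d) (k % d)) ⟩
    iterate σ X (k % d + k ℕ./ d * d)              ≡⟨ cong (iterate σ X) (m≡m%n+[m/n]*n k d) ⟨
    iterate σ X k                                ∎

  window-resp : ∀ {a a′ b b′ c c′} → a ≡ a′ → b ≡ b′ → c ≡ c′ → Window a b c → Window a′ b′ c′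
  window-resp refl refl refl w = w

  MIS-iterate : {X : Subset n} (k : ℕ) → IsMIS X → IsMIS (iterate σ X k)
  MIS-iterate {X} k mis = windows⇒MIS (iterate σ X k) λ j _ →
    window-resp (sym (ext-rotate X k j)) (sym (ext-rotate X k (1 + j))) (sym (ext-rotate X k (2 + j)))
                (MIS⇒windows X mis (j + k * pred n))

  ∈Orbit-iterate : (X : Subset n) (k : ℕ) → iterate σ X k ∈Orbit X
  ∈Orbit-iterate X k = k mod n ,
    trans (cong (iterate σ X) (toℕ-mod k n)) (iterate-% X (ext-periodic X) k)

  ∈Orbit-refl : (X : Subset n) → X ∈Orbit X
  ∈Orbit-refl X = ∈Orbit-iterate X 0

  ∈Orbit-sym : {X Y : Subset n} → Y ∈Orbit X → X ∈Orbit Y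
  ∈Orbit-sym {X} (i , refl) = subst (_∈Orbit iterate σ X k) (begin
    iterate σ (iterate σ X k) (k * pred n)  ≡⟨ iterate-+ σ X k (k * pred n) ⟨
    iterate σ X (k + k * pred n)            ≡⟨ cong (iterate σ X) (k+k*pred k) ⟩
    iterate σ X (k * n)                     ≡⟨ periodic⇒iterate≡ X (periodic-* k (ext-periodic X)) ⟩
    X                                       ∎)
    (∈Orbit-iterate (iterate σ X k) (k * pred n))
    where k = toℕ i

  ∈Orbit-trans : {X Y Z : Subset n} → Y ∈Orbit X → Z ∈Orbit Y → Z ∈Orbit X
  ∈Orbit-trans {X} (i , refl) (j , refl) =
    subst (_∈Orbit X) (iterate-+ σ X (toℕ i) (toℕ j)) (∈Orbit-iterate X (toℕ i + toℕ j))

-- Enumerations without repetition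

∈-subsets : (X : Subset n) → X ∈ subsets n
∈-subsets []      = here refl
∈-subsets (b ∷ X) = ∈-cartesianProductWith⁺ Vec._∷_ (∈-bools b) (∈-subsets X)
  where
  ∈-bools : ∀ b → b ∈ inside ∷ outside ∷ []
  ∈-bools true  = here refl
  ∈-bools false = there (here refl)

subsets-! : ∀ n → Unique (subsets n)
subsets-! zero    = [] ∷ []
subsets-! (suc n) = cartesianProductWith⁺ Vec._∷_ (λ { refl → refl , refl })
  (((λ ()) ∷ []) ∷ [] ∷ []) (subsets-! n)

𝐗-! : ∀ n → Unique (𝐗 n)
𝐗-! n = filter⁺ isMIS? (subsets-! n)

∈-𝐗⁺ : {X : Subset n} → IsMIS X → X ∈ 𝐗 n
∈-𝐗⁺ {X = X} = ∈-filter⁺ isMIS? (∈-subsets X)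

∈-𝐗⁻ : {X : Subset n} → X ∈ 𝐗 n → IsMIS X
∈-𝐗⁻ {n} X∈ = proj₂ (∈-filter⁻ isMIS? {xs = subsets n} X∈)

orbit-! : (X : Subset n) → Unique (orbit X)
orbit-! {n} X = filter⁺ (_∈Orbit? X) (subsets-! n)

∈-orbit⁺ : {X Y : Subset n} → Y ∈Orbit X → Y ∈ orbit X
∈-orbit⁺ {X = X} {Y} = ∈-filter⁺ (_∈Orbit? X) (∈-subsets Y)

∈-orbit⁻ : {X Y : Subset n} → Y ∈ orbit X → Y ∈Orbit X
∈-orbit⁻ {n} {X} Y∈ = proj₂ (∈-filter⁻ (_∈Orbit? X) {xs = subsets n} Y∈)

module _ .{{_ : NonZero n}} {X Y : Subset n} where

  -- Both orbits filter the same list `subsets n`, so equivalent membership conditions give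
  -- literally equal lists.
  ∈Orbit⇒orbit≡ : Y ∈Orbit X → orbit Y ≡ orbit X
  ∈Orbit⇒orbit≡ Y∈X = List.filter-≐ (_∈Orbit? Y) (_∈Orbit? X)
    (∈Orbit-trans Y∈X , ∈Orbit-trans (∈Orbit-sym Y∈X)) (subsets n)

  orbit≡⇒∈Orbit : orbit Y ≡ orbit X → Y ∈Orbit X
  orbit≡⇒∈Orbit eq = ∈-orbit⁻ (subst (Y ∈_) eq (∈-orbit⁺ (∈Orbit-refl Y)))

-- Minimal periods and orbit sizes

least : {P : ℕ → Set} → Decidable P → ∀ n → P n → ∃ λ m → P m × (∀ l → l < m → ¬ P l)
least {P} P? = <-rec (λ n → P n → ∃ λ m → P m × (∀ l → l < m → ¬ P l)) search
  where
  search : ∀ n → (∀ {m} → m < n → P m → _) → P n → _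
  search n rec Pn with anyUpTo? P? n
  ... | yes (m , m<n , Pm) = rec m<n Pm
  ... | no ∄m              = n , Pn , λ l l<n Pl → ∄m (l , l<n , Pl)

module _ .{{_ : NonZero n}} (X : Subset n) where

  -- Write a period as `k = q * d + r` with `r < d`, where `d` is the least positive period.
  -- Cancelling the period `q * d` leaves `r`, which is 0 by minimality.
  minimalPeriod : ∃ λ d → NonZero d × (∀ k → Periodic (ext X) k ⇔ d ∣ k)
  -- Searching over successors keeps the period positive; the search starts from `n` itself, written
  -- as `suc (pred n)`.
  minimalPeriod with m , X-d , minimal ← least (periodic? X ∘ suc) (pred n)
                       (subst (Periodic (ext X)) (sym (suc-pred n)) (ext-periodic X)) =
    d , _ , λ k → mk⇔ (divides-period k) (λ { (divides q refl) → periodic-* q X-d })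
    where
    d = suc m

    divides-period : ∀ k → Periodic (ext X) k → d ∣ k
    divides-period k X-k with k % d in eq
    ... | zero  = m%n≡0⇒n∣m k d eq
    ... | suc l = contradiction
      (periodic-+-cancel {k = k ℕ./ d * d} (periodic-* (k ℕ./ d) X-d)
        (subst (Periodic (ext X)) (begin
          k                      ≡⟨ m≡m%n+[m/n]*n k d ⟩
          k % d + k ℕ./ d * d      ≡⟨ cong (λ r → r + k ℕ./ d * d) eq ⟩
          suc l + k ℕ./ d * d      ≡⟨ +-comm (suc l) _ ⟩
          k ℕ./ d * d + suc l      ∎) X-k))
      (minimal l (s<s⁻¹ (subst (_< d) eq (m%n<n k d))))

  -- The exponents below `d` run through the orbit once: those of equal rotations differ by a
  -- period, and a multiple of `d` below `d` is 0.
  ∣orbit∣≡minimalPeriod : ∀ d .{{_ : NonZero d}} → (∀ k → Periodic (ext X) k ⇔ d ∣ k) → d ≡ length (orbit X)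
  ∣orbit∣≡minimalPeriod d period⇔ = trans (sym (List.length-upTo d))
    (length-reindex _≟ˢ_ (iterate σ X) (upTo⁺ d) (orbit-! X)
      (λ {k} _ → ∈-orbit⁺ (∈Orbit-iterate X k))
      (λ k∈ l∈ → injective (∈-upTo⁻ k∈) (∈-upTo⁻ l∈))
      (λ Y∈ → let i , eq = ∈-orbit⁻ Y∈ in
        toℕ i % d , ∈-upTo⁺ (m%n<n (toℕ i) d) ,
        trans (iterate-% X (from (period⇔ d) ∣-refl) (toℕ i)) eq))
    where
    ordered : ∀ {k l} → k ≤ l → l < d → iterate σ X k ≡ iterate σ X l → k ≡ l
    ordered {k} {l} k≤l l<d eq with m , refl ← m≤n⇒∃[o]m+o≡n k≤l
      with to (period⇔ m) (iterate≡⇒periodic X k m eq)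
    ... | d∣m with m
    ...   | zero  = sym (+-identityʳ k)
    ...   | suc _ = contradiction d∣m (>⇒∤ (≤-<-trans (m≤n+m _ k) l<d))

    injective : ∀ {k l} → k < d → l < d → iterate σ X k ≡ iterate σ X l → k ≡ l
    injective {k} {l} k<d l<d eq with ≤-total k l
    ... | inj₁ k≤l = ordered k≤l l<d eq
    ... | inj₂ l≤k = sym (ordered l≤k k<d (sym eq))

  periodic⇔∣orbit∣ : ∀ k → Periodic (ext X) k ⇔ length (orbit X) ∣ k
  periodic⇔∣orbit∣ k with d , d≢0 , period⇔ ← minimalPeriod =
    subst (λ d → Periodic (ext X) k ⇔ d ∣ k) (∣orbit∣≡minimalPeriod d {{d≢0}} period⇔) (period⇔ k)

-- The periods depend on the sequence alone and are the multiples of the orbit size, so the two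
-- sizes divide each other although the orbits belong to different cycles.
∣orbit∣-cong : .{{_ : NonZero m}} .{{_ : NonZero n}} (X : Subset m) (Y : Subset n) →
               ext X ≗ ext Y → length (orbit X) ≡ length (orbit Y)
∣orbit∣-cong X Y X≗Y = ∣-antisym
  (to (periodic⇔∣orbit∣ X _) (periodic-cong (sym ∘ X≗Y) (from (periodic⇔∣orbit∣ Y _) ∣-refl)))
  (to (periodic⇔∣orbit∣ Y _) (periodic-cong X≗Y (from (periodic⇔∣orbit∣ X _) ∣-refl)))

-- Counting orbits

-- Serves as restriction when `m` is a smaller period of the sequence and as unrolling when `m` is a
-- multiple of `n`.
resize : .{{_ : NonZero n}} → (m : ℕ) → Subset n → Subset m
resize m X = tabulate (ext X ∘ toℕ)

ext-resize : .{{_ : NonZero m}} .{{_ : NonZero n}} (X : Subset n) →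
             Periodic (ext X) m → ext (resize m X) ≗ ext X
ext-resize {m} X X-m j = begin
  lookup (tabulate (ext X ∘ toℕ)) (j mod m)  ≡⟨ lookup∘tabulate (ext X ∘ toℕ) (j mod m) ⟩
  ext X (toℕ (j mod m))                      ≡⟨ cong (ext X) (toℕ-mod j m) ⟩
  ext X (j % m)                              ≡⟨ periodic-% X-m j ⟩
  ext X j                                    ∎

MIS-ext : .{{_ : NonZero m}} .{{_ : NonZero n}} {X : Subset m} {Y : Subset n} →
          ext X ≗ ext Y → IsMIS X → IsMIS Y
MIS-ext {X = X} {Y} X≗Y mis = windows⇒MIS Y λ j _ →
  window-resp (X≗Y j) (X≗Y (1 + j)) (X≗Y (2 + j)) (MIS⇒windows X mis j)

infix 4 _≟ᴼ_
_≟ᴼ_ : DecidableEquality (List (Subset n))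
_≟ᴼ_ = List.≡-dec _≟ˢ_

-- `orbσ[ d ] n` fixes the size `n / d`; here the size itself is the parameter, so that it can be
-- kept while `n` changes.
orbitsOfSize : ℕ → ℕ → ℕ
orbitsOfSize n d = length (filter (λ O → length O ≟ d) (orbits n))

𝐗ofOrbitSize : ∀ n → ℕ → List (Subset n)
𝐗ofOrbitSize n d = filter (λ X → length (orbit X) ≟ d) (𝐗 n)

module _ (n : ℕ) .{{_ : NonZero n}} where

  orbits-! : Unique (orbits n)
  orbits-! = deduplicate-! _≟ᴼ_ (map orbit (𝐗 n))

  orbit∈orbits : {X : Subset n} → X ∈ 𝐗 n → orbit X ∈ orbits n
  orbit∈orbits X∈ = ∈-deduplicate⁺ _≟ᴼ_ (∈-map⁺ orbit X∈)

  ∈-orbits⁻ : {O : List (Subset n)} → O ∈ orbits n → ∃ λ X → X ∈ 𝐗 n × O ≡ orbit X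
  ∈-orbits⁻ O∈ = ∈-map⁻ orbit (∈-deduplicate⁻ _≟ᴼ_ (map orbit (𝐗 n)) O∈)

  -- The fibre consists of the members of `O`, because rotations of a member of `𝐗 n` stay in `𝐗 n`.
  length-orbit-fibre : {O : List (Subset n)} → O ∈ orbits n →
                       length (filter (λ X → orbit X ≟ᴼ O) (𝐗 n)) ≡ length O
  length-orbit-fibre O∈ with X , X∈ , refl ← ∈-orbits⁻ O∈ =
    length-reindex _≟ˢ_ id (filter⁺ (λ Y → orbit Y ≟ᴼ orbit X) (𝐗-! n)) (orbit-! X)
      (λ Y∈ → ∈-orbit⁺ (orbit≡⇒∈Orbit (proj₂ (∈-filter⁻ (λ Y → orbit Y ≟ᴼ orbit X) {xs = 𝐗 n} Y∈))))
      (λ _ _ → id)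
      (λ {Y} Y∈ → let Y∈X = ∈-orbit⁻ Y∈ in
        Y , ∈-filter⁺ (λ Y → orbit Y ≟ᴼ orbit X) (∈-𝐗⁺ (orbit-MIS (∈-𝐗⁻ X∈) Y∈X)) (∈Orbit⇒orbit≡ Y∈X) , refl)
    where
    orbit-MIS : ∀ {X Y : Subset n} → IsMIS X → Y ∈Orbit X → IsMIS Y
    orbit-MIS mis (i , refl) = MIS-iterate (toℕ i) mis

  ∑-𝐗 : (g : List (Subset n) → ℤ) → ∑ (𝐗 n) (g ∘ orbit) ≡ ∑ (orbits n) (λ O → + length O ℤ.* g O)
  ∑-𝐗 g = trans (∑-fibre _≟ᴼ_ orbit g orbits-! orbit∈orbits)
    (∑-cong (orbits n) λ {O} O∈ → cong (λ k → + k ℤ.* g O) (length-orbit-fibre O∈))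

  ∣orbit∣∣n : {O : List (Subset n)} → O ∈ orbits n → length O ∣ n
  ∣orbit∣∣n O∈ with X , _ , refl ← ∈-orbits⁻ O∈ = to (periodic⇔∣orbit∣ X n) (ext-periodic X)

  ∑-orbits : (g : ℕ → ℤ) → ∑ (orbits n) (g ∘ length) ≡ ∑ (divisors n) (λ d → + orbitsOfSize n d ℤ.* g d)
  ∑-orbits g = ∑-fibre _≟_ length g (divisors-! n) (∈-divisors⁺ ∘ ∣orbit∣∣n)

  ∣𝐗ofOrbitSize∣ : ∀ d → length (𝐗ofOrbitSize n d) ≡ orbitsOfSize n d * d
  ∣𝐗ofOrbitSize∣ d = ℤ.+-injective (begin
    + length (𝐗ofOrbitSize n d)
      ≡⟨ ∑-𝟙 (λ X → length (orbit X) ≟ d) (𝐗 n) ⟨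
    ∑ (𝐗 n) (λ X → 𝟙 (length (orbit X) ≟ d))
      ≡⟨ ∑-𝐗 (λ O → 𝟙 (length O ≟ d)) ⟩
    ∑ (orbits n) (λ O → + length O ℤ.* 𝟙 (length O ≟ d))
      ≡⟨ ∑-cong (orbits n) (λ {O} _ → absorb (length O ≟ d)) ⟩
    ∑ (orbits n) (λ O → 𝟙 (length O ≟ d) ℤ.* + d)
      ≡⟨ ∑-*ʳ (orbits n) _ (+ d) ⟩
    ∑ (orbits n) (λ O → 𝟙 (length O ≟ d)) ℤ.* + d
      ≡⟨ cong (ℤ._* + d) (∑-𝟙 (λ O → length O ≟ d) (orbits n)) ⟩
    + orbitsOfSize n d ℤ.* + d
      ≡⟨ ℤ.pos-* (orbitsOfSize n d) d ⟨
    + (orbitsOfSize n d * d) ∎)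
    where
    absorb : ∀ {k} (k≡d? : Dec (k ≡ d)) → + k ℤ.* 𝟙 k≡d? ≡ 𝟙 k≡d? ℤ.* + d
    absorb     (yes refl) = ℤ.*-comm (+ d) 1ℤ
    absorb {k} (no _)     = ℤ.*-zeroʳ (+ k)

-- A set of period d | n is determined by its restriction to ℤ_d.
∣𝐗ofOrbitSize∣-∣ : ∀ {d n} .{{_ : NonZero d}} .{{_ : NonZero n}} → d ∣ n →
                   length (𝐗ofOrbitSize n d) ≡ length (𝐗ofOrbitSize d d)
∣𝐗ofOrbitSize∣-∣ {d} {n} (divides q refl) = length-reindex _≟ˢ_ (resize d)
  (filter⁺ (λ X → length (orbit X) ≟ d) (𝐗-! n)) (filter⁺ (λ X → length (orbit X) ≟ d) (𝐗-! d))
  (λ {X} X∈ → let X∈𝐗 , ∣X∣≡d = ∈⁻ X∈ ; Z≗X = restrict X∈ in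
    ∈⁺ (MIS-ext (sym ∘ Z≗X) X∈𝐗) (trans (∣orbit∣-cong (resize d X) X Z≗X) ∣X∣≡d))
  (λ X∈ Y∈ eq → ext-injective λ j →
    trans (sym (restrict X∈ j)) (trans (cong (λ Z → ext Z j) eq) (restrict Y∈ j)))
  -- The preimage of `Y` is its unrolling to `n = q * d`. It keeps the period `d`, so cutting it
  -- back to `d` returns `Y`.
  (λ {Y} Y∈ → let Y∈𝐗 , ∣Y∣≡d = ∈⁻ Y∈ ; X≗Y = extend Y in
    resize n Y ,
    ∈⁺ (MIS-ext (sym ∘ X≗Y) Y∈𝐗) (trans (∣orbit∣-cong (resize n Y) Y X≗Y) ∣Y∣≡d) ,
    ext-injective λ j → trans
      (ext-resize (resize n Y) (periodic-cong (sym ∘ X≗Y) (ext-periodic Y)) j) (X≗Y j))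
  where
  ∈⁻ : ∀ {m} {X : Subset m} → X ∈ 𝐗ofOrbitSize m d → IsMIS X × length (orbit X) ≡ d
  ∈⁻ {m} X∈ with X∈𝐗 , ∣X∣≡d ← ∈-filter⁻ (λ X → length (orbit X) ≟ d) {xs = 𝐗 m} X∈ =
    ∈-𝐗⁻ X∈𝐗 , ∣X∣≡d

  ∈⁺ : ∀ {m} {X : Subset m} → IsMIS X → length (orbit X) ≡ d → X ∈ 𝐗ofOrbitSize m d
  ∈⁺ mis = ∈-filter⁺ (λ X → length (orbit X) ≟ d) (∈-𝐗⁺ mis)

  restrict : {X : Subset n} → X ∈ 𝐗ofOrbitSize n d → ext (resize d X) ≗ ext X
  restrict {X} X∈ = ext-resize X (from (periodic⇔∣orbit∣ X d) (∣-reflexive (proj₂ (∈⁻ X∈))))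

  extend : (Y : Subset d) → ext (resize n Y) ≗ ext Y
  extend Y = ext-resize Y (periodic-* q (ext-periodic Y))

-- The corresponding counts of sets agree, and the nonzero factor `d` cancels.
orbitsOfSize-∣ : ∀ {d n} .{{_ : NonZero n}} → d ∣ n → orbitsOfSize n d ≡ orbσ[ 1 ] d
orbitsOfSize-∣ {d} {n} d∣n = begin
  orbitsOfSize n d
    ≡⟨ *-cancelʳ-≡ _ _ d (begin
         orbitsOfSize n d * d         ≡⟨ ∣𝐗ofOrbitSize∣ n d ⟨
         length (𝐗ofOrbitSize n d)    ≡⟨ ∣𝐗ofOrbitSize∣-∣ d∣n ⟩
         length (𝐗ofOrbitSize d d)    ≡⟨ ∣𝐗ofOrbitSize∣ d d ⟩
         orbitsOfSize d d * d         ∎) ⟩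
  orbitsOfSize d d
    ≡⟨ cong (orbitsOfSize d) (n/1≡n d) ⟨
  orbσ[ 1 ] d ∎
  where
  instance
    d≢0 : NonZero d
    d≢0 = ∣-nonZero d∣n

-- The two equations

orbσ≡∑ : ∀ n .{{_ : NonZero n}} → + orbσ n ≡ ((λ d → + orbσ[ 1 ] d) ∗ 𝟏) n
orbσ≡∑ n = begin
  + orbσ n                                         ≡⟨ ∑-1 (orbits n) ⟨
  ∑ (orbits n) (const 1ℤ)                          ≡⟨ ∑-orbits n (const 1ℤ) ⟩
  ∑ (divisors n) (λ d → + orbitsOfSize n d ℤ.* 1ℤ)
    ≡⟨ ∑-cong (divisors n) (λ d∈ → cong (λ k → + k ℤ.* 1ℤ) (orbitsOfSize-∣ (∈-divisors⁻ n d∈))) ⟩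
  ∑ (divisors n) (λ d → + orbσ[ 1 ] d ℤ.* 1ℤ)      ≡⟨ ∗-divisors (λ d → + orbσ[ 1 ] d) 𝟏 n ⟨
  ((λ d → + orbσ[ 1 ] d) ∗ 𝟏) n                    ∎

p≡∑ : ∀ n .{{_ : NonZero n}} → + p n ≡ ∑ (divisors n) (λ d → + orbσ[ 1 ] d ℤ.* + d)
p≡∑ n = begin
  + p n                                             ≡⟨ cong (λ k → + k) (∣𝐗∣≡p n) ⟨
  + length (𝐗 n)                                    ≡⟨ ∑-1 (𝐗 n) ⟨
  ∑ (𝐗 n) (const 1ℤ)                                ≡⟨ ∑-𝐗 n (const 1ℤ) ⟩
  ∑ (orbits n) (λ O → + length O ℤ.* 1ℤ)
    ≡⟨ ∑-cong (orbits n) (λ _ → ℤ.*-identityʳ _) ⟩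
  ∑ (orbits n) (λ O → + length O)                   ≡⟨ ∑-orbits n (λ d → + d) ⟩
  ∑ (divisors n) (λ d → + orbitsOfSize n d ℤ.* + d)
    ≡⟨ ∑-cong (divisors n) (λ {d} d∈ → cong (λ k → + k ℤ.* + d) (orbitsOfSize-∣ (∈-divisors⁻ n d∈))) ⟩
  ∑ (divisors n) (λ d → + orbσ[ 1 ] d ℤ.* + d)      ∎

-- `_/_` reduces fractions to lowest terms, so the equality is checked on unreduced ones, where it
-- is cross-multiplication.
*-/-cancel : ∀ i n .{{_ : NonZero n}} → (i ℤ.* + n) / n ≡ i / 1
*-/-cancel i n@(suc n-1) = ℚ.fromℚᵘ-cong {mkℚᵘ (i ℤ.* + n) n-1} {mkℚᵘ i 0} (*≡* (ℤ.*-identityʳ (i ℤ.* + n)))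

theorem4p1 : (n : ℕ) .{{_ : NonZero n}} →
    (+ orbσ n ≡ ((λ d → + orbσ[ 1 ] d) ∗ 𝟏) n) ×
    ((+ orbσ[ 1 ] n) / 1 ≡ A113788 n)
theorem4p1 n = orbσ≡∑ n , (begin
  + orbσ[ 1 ] n / 1                    ≡⟨ *-/-cancel (+ orbσ[ 1 ] n) n ⟨
  -- The inverted function carries the factor `d`, so at `n` inversion returns `n` times the wanted
  -- number, and the division by `n` in `A113788` removes it.
  (+ orbσ[ 1 ] n ℤ.* + n) / n
    ≡⟨ cong (_/ n) (möbius-inversion (λ m → + p m) (λ d → + orbσ[ 1 ] d ℤ.* + d) p≡∑ n) ⟨
  A113788 n                              ∎)
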